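{- Let $t \geq 1$ and $p \geq 3$ be integers. Let $m_1, \dots, m_p$ be distinct real numbers and $c_1, \dots, c_p$ be distinct real numbers. For $i, j \in [p]$ let $L_{i,j}$ be the line $\{(x, m_i x + c_j) : x \in \mathbb{R}\} \subseteq \mathbb{R}^2$, and let $A_{i,j}$ be the set of points $(a,b) \in \mathbb{R}^2$ for which there exist $i', j' \in [p]$ with $(i',j') \neq (i,j)$ such that $L_{i,j}$ and $L_{i',j'}$ intersect at $(a,b)$. To each point $(a,b)$ in $\bigcup_{i,j} A_{i,j}$ assign a $t$-element set $T_{(a,b)}$, these sets being pairwise disjoint, and let $B_{i,j} = \bigcup_{(a,b) \in A_{i,j}} T_{(a,b)}$. Let $\mathcal{B} = \{B_{i,j} : i, j \in [p]\}$. Let $\mathcal{L}$ be a largest $t$-intersecting sub-family of $\mathcal{B}$, let $k \geq 1$ be an integer and let $\mathcal{A}_1, \dots, \mathcal{A}_k$ be cross-$t$-intersecting sub-families of $\mathcal{B}$. Then: (i) $\kappa(\mathcal{B},t) = |\mathcal{L}| = p$; (ii) if $k \geq \kappa(\mathcal{B},t)$ and $\mathcal{A}_1 = \dots = \mathcal{A}_k = \mathcal{L}$, then $\prod_{i=1}^k |\mathcal{A}_i|$ is maximum among all $k$-tuples of cross-$t$-intersecting sub-families of $\mathcal{B}$; (iii) if $k < \kappa(\mathcal{B},t)$ and $\mathcal{A}_1 = \dots = \mathcal{A}_k = \mathcal{L}$, then $\prod_{i=1}^k |\mathcal{A}_i|$ is not maximum among all $k$-tuples of cross-$t$-intersecting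 sub-families of $\mathcal{B}$.
   Context: $[p] = \{1,\dots,p\}$. A family $\mathcal{A}$ is $t$-intersecting if $|A \cap B| \geq t$ for all $A, B \in \mathcal{A}$ with $A \neq B$. Families $\mathcal{A}_1, \dots, \mathcal{A}_k$ (not necessarily distinct or non-empty) are cross-$t$-intersecting if for all $i \neq j$, $|A \cap B| \geq t$ for every $A \in \mathcal{A}_i$, $B \in \mathcal{A}_j$. $l(\mathcal{F},t)$ is the size of a largest $t$-intersecting sub-family of $\mathcal{F}$. For a family $\mathcal{A}$, $\mathcal{A}^{t,+} = \{A \in \mathcal{A} : |A \cap B| \geq t \text{ for all } B \in \mathcal{A}\setminus\{A\}\}$ and $\mathcal{A}^{t,- } = \mathcal{A} \setminus \mathcal{A}^{t,+}$. For $\mathcal{A} \subseteq \mathcal{F}$, $\beta(\mathcal{F},t,\mathcal{A}) = \frac{l(\mathcal{F},t) - |\mathcal{A}^{t,+}|}{|\mathcal{A}^{t,- }|}$ if $\mathcal{A}^{t,- } \neq \emptyset$, and $\frac{l(\mathcal{F},t)}{|\mathcal{F}|}$ otherwise; $\beta(\mathcal{F},t) = \min_{\mathcal{A} \subseteq \mathcal{F}} \beta(\mathcal{F},t,\mathcal{A})$ and $\kappa(\mathcal{F},t) = 1/\beta(\mathcal{F},t)$. -}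

module Defs where

open import Level using (Level; 0ℓ; _⊔_) renaming (suc to lsuc)
open import Algebra.Apartness.Bundles using (HeytingCommutativeRing; HeytingField)
import Algebra.Definitions.RawMonoid as RawMonoidDefinitions
open import Algebra.Bundles using (CommutativeRing)
open import Data.Fin.Base using (Fin)
open import Data.Integer.Base as ℤ using (+_)
open import Data.List.Base using (List; length)
open import Data.List.Relation.Unary.All using (All)
open import Data.Nat.Base as ℕ using (ℕ; suc)
open import Data.Product.Base using (Σ-syntax; ∃; ∃-syntax; _×_; _,_)
open import Data.Product.Relation.Binary.Pointwise.NonDependent using (Pointwise)
open import Data.Rational.Base as ℚ using (ℚ)
open import Data.Sum.Base using (_⊎_)
open import Data.Vec.Functional using (foldr)
open import Function.Bundles using (_⇔_)
open import Relation.Binary.Bundles using (Setoid)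
open import Relation.Binary.Core using (Rel)
open import Relation.Binary.PropositionalEquality using (_≡_; _≢_)
open import Relation.Binary.PropositionalEquality.Properties using (setoid)
open import Relation.Binary.Structures using (IsStrictPartialOrder)
open import Relation.Nullary.Negation using (¬_)
open import Relation.Unary using (Pred; _∈_; _∩_; _≐_; _⊥_; Empty)
open import Relation.Unary.Relation.Binary.Equality using (≐-setoid)
import Data.List.Membership.Setoid as Membership
import Data.List.Relation.Unary.Unique.Setoid as Uniqueness

private
  variable
    ℓ : Level
    X : Set

-- ℝ is axiomatised as an Archimedean, Cauchy-complete ordered field.
-- Classically these axioms determine ℝ up to isomorphism, and `x # y` is
-- then the same as `¬ (x ≈ y)`.  Trichotomy of the order is deliberately
-- not an axiom, so that the constructive (Bishop) reals are also a model;
-- there, as here, "distinct" reals are reals that are apart.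

record RealNumbers : Set₁ where
  field
    heytingField : HeytingField 0ℓ 0ℓ 0ℓ

  open HeytingField heytingField public
  open HeytingCommutativeRing heytingCommutativeRing public using (commutativeRing)
  open RawMonoidDefinitions (CommutativeRing.+-rawMonoid commutativeRing)
    using () renaming (_×_ to _·_)

  infix 4 _<_

  field
    _<_                    : Rel Carrier 0ℓ
    <-isStrictPartialOrder : IsStrictPartialOrder _≈_ _<_
    #⇔<⊎>                  : ∀ {x y} → x # y ⇔ (x < y ⊎ y < x)
    +-monoˡ-<              : ∀ {x y} z → x < y → x + z < y + z
    *-pos                  : ∀ {x y} → 0# < x → 0# < y → 0# < x * y
    archimedean            : ∀ x → ∃[ n ] x < n · 1#

  -- Since k and n range over the same tail, the one-sided bound gives
  -- ∣ s k - s n ∣ < ε.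
  IsCauchy : (ℕ → Carrier) → Set
  IsCauchy s = ∀ {ε} → 0# < ε →
    ∃[ N ] (∀ k n → N ℕ.≤ k → N ℕ.≤ n → s k < s n + ε)

  ConvergesTo : (ℕ → Carrier) → Carrier → Set
  ConvergesTo s a = ∀ {ε} → 0# < ε →
    ∃[ N ] (∀ n → N ℕ.≤ n → s n < a + ε × a < s n + ε)

  field
    complete : ∀ s → IsCauchy s → ∃ (ConvergesTo s)

module Cardinality {c e} (S : Setoid c e) where
  open Setoid S using (Carrier)
  open Membership S using () renaming (_∈_ to _∈ₗ_)
  open Uniqueness S using (Unique)

  HasSize : Pred Carrier ℓ → ℕ → Set (c ⊔ e ⊔ ℓ)
  HasSize P n = ∃[ xs ] Unique xs × length xs ≡ n × (∀ x → x ∈ P ⇔ x ∈ₗ xs)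

  -- For a finite P this says n ≤ ∣P∣; it does not require P to be enumerated.
  HasSizeAtLeast : Pred Carrier ℓ → ℕ → Set (c ⊔ e ⊔ ℓ)
  HasSizeAtLeast P n = ∃[ xs ] Unique xs × length xs ≡ n × All P xs

-- A set over X is a predicate on X; equality of sets is _≐_.

Sets : Set → Setoid _ _
Sets X = ≐-setoid X 0ℓ

Family : Set → (ℓ : Level) → Set _
Family X ℓ = Pred (Pred X 0ℓ) ℓ

-- A finite sub-family of 𝓕, enumerated without repetition.

record SubFamily {X : Set} (𝓕 : Family X ℓ) : Set (lsuc 0ℓ ⊔ ℓ) where
  open Uniqueness (Sets X) using (Unique)
  field
    members : List (Pred X 0ℓ)
    unique  : Unique members
    sub     : All 𝓕 members

open SubFamily public using (members)

module _ {X : Set} {𝓕 : Family X ℓ} where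

  open Membership (Sets X) using () renaming (_∈_ to _∈ₗ_)
  open Cardinality (setoid X) using () renaming (HasSizeAtLeast to HasAtLeast)

  infix 4 _∈ᶠ_ _≋_

  _∈ᶠ_ : Pred X 0ℓ → SubFamily 𝓕 → Set₁
  A ∈ᶠ 𝒜 = A ∈ₗ members 𝒜

  _≋_ : SubFamily 𝓕 → SubFamily 𝓕 → Set₁
  𝒜 ≋ 𝒜′ = ∀ A → A ∈ᶠ 𝒜 ⇔ A ∈ᶠ 𝒜′

  ∣_∣ : SubFamily 𝓕 → ℕ
  ∣ 𝒜 ∣ = length (members 𝒜)

  IsIntersecting : ℕ → SubFamily 𝓕 → Set₁
  IsIntersecting t 𝒜 = ∀ A B → A ∈ᶠ 𝒜 → B ∈ᶠ 𝒜 → ¬ (A ≐ B) → HasAtLeast (A ∩ B) t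

  IsLargestIntersecting : ℕ → SubFamily 𝓕 → Set (lsuc 0ℓ ⊔ ℓ)
  IsLargestIntersecting t 𝓛 =
    IsIntersecting t 𝓛 × (∀ 𝒜 → IsIntersecting t 𝒜 → ∣ 𝒜 ∣ ℕ.≤ ∣ 𝓛 ∣)

  AreCrossIntersecting : ∀ {k} → ℕ → (Fin k → SubFamily 𝓕) → Set₁
  AreCrossIntersecting t 𝒜 =
    ∀ i j → i ≢ j → ∀ A B → A ∈ᶠ 𝒜 i → B ∈ᶠ 𝒜 j → HasAtLeast (A ∩ B) t

  productOfSizes : ∀ {k} → (Fin k → SubFamily 𝓕) → ℕ
  productOfSizes 𝒜 = foldr ℕ._*_ 1 (λ i → ∣ 𝒜 i ∣)

  HasMaximumProduct : ∀ {k} → ℕ → (Fin k → SubFamily 𝓕) → Set (lsuc 0ℓ ⊔ ℓ)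
  HasMaximumProduct {k} t 𝒜 = ∀ (𝒜′ : Fin k → SubFamily 𝓕) →
    AreCrossIntersecting t 𝒜′ → productOfSizes 𝒜′ ℕ.≤ productOfSizes 𝒜

  -- Plus t 𝒜 is 𝒜^{t,+} and Minus t 𝒜 is 𝒜^{t,-}.

  Plus : ℕ → SubFamily 𝓕 → Family X (lsuc 0ℓ)
  Plus t 𝒜 A = A ∈ᶠ 𝒜 × (∀ B → B ∈ᶠ 𝒜 → ¬ (B ≐ A) → HasAtLeast (A ∩ B) t)

  Minus : ℕ → SubFamily 𝓕 → Family X (lsuc 0ℓ)
  Minus t 𝒜 A = A ∈ᶠ 𝒜 × ¬ (A ∈ Plus t 𝒜)

-- Sizes of families given by predicates, and maxima and minima over all
-- sub-families, are not computable functions in general, so l, β and κ are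
-- given by their graphs: `Is-l 𝓕 t n` says l(𝓕,t) = n, and so on.

fromℕ : ℕ → ℚ
fromℕ n = + n ℚ./ 1

module _ {X : Set} (𝓕 : Family X ℓ) (t : ℕ) where

  open Cardinality (Sets X) using (HasSize)

  Is-l : ℕ → Set (lsuc 0ℓ ⊔ ℓ)
  Is-l n = ∃[ 𝓛 ] IsLargestIntersecting {𝓕 = 𝓕} t 𝓛 × ∣ 𝓛 ∣ ≡ n

  -- `Is-βAt 𝒜 q` says β(𝓕,t,𝒜) = q.

  data Is-βAt (𝒜 : SubFamily 𝓕) : ℚ → Set (lsuc 0ℓ ⊔ ℓ) where
    minus-nonempty : ∀ {l a b} → Is-l l →
      HasSize (Plus t 𝒜) a → HasSize (Minus t 𝒜) (suc b) →
      Is-βAt 𝒜 ((+ l ℤ.- + a) ℚ./ suc b)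
    minus-empty : ∀ {l f} → Is-l l →
      Empty (Minus t 𝒜) → HasSize 𝓕 (suc f) →
      Is-βAt 𝒜 (+ l ℚ./ suc f)

  Is-β : ℚ → Set (lsuc 0ℓ ⊔ ℓ)
  Is-β β = (∃[ 𝒜 ] Is-βAt 𝒜 β) × (∀ 𝒜 q → Is-βAt 𝒜 q → β ℚ.≤ q)

  Is-κ : ℚ → Set (lsuc 0ℓ ⊔ ℓ)
  Is-κ κ = ∃[ β ] Is-β β × Σ[ β≢0 ∈ ℚ.NonZero β ] κ ≡ (ℚ.1/ β) {{β≢0}}

module Lines (ℝ : RealNumbers) where

  open RealNumbers ℝ using (Carrier; _≈_; _#_; _+_; _*_)

  Point : Set
  Point = Carrier × Carrier

  infix 4 _≈ₚ_

  _≈ₚ_ : Rel Point 0ℓ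
  _≈ₚ_ = Pointwise _≈_ _≈_

  Distinct : ∀ {p} → (Fin p → Carrier) → Set
  Distinct v = ∀ i j → i ≢ j → v i # v j

  module _ {p : ℕ} (m c : Fin p → Carrier) where

    Line : Fin p → Fin p → Pred Point 0ℓ
    Line i j P = ∃[ x ] P ≈ₚ (x , m i * x + c j)

    Crossings : Fin p → Fin p → Pred Point 0ℓ
    Crossings i j P = ∃[ i′ ] ∃[ j′ ]
      (i′ , j′) ≢ (i , j) × P ∈ Line i j ∩ Line i′ j′

    AllCrossings : Pred Point 0ℓ
    AllCrossings P = ∃[ i ] ∃[ j ] P ∈ Crossings i j

    -- T is given on all of ℝ², but it is only constrained, and only used,
    -- at the crossing points.

    record IsDisjointAssignment (t : ℕ) (T : Point → Pred X 0ℓ) : Set where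
      open Cardinality (setoid X) using (HasSize)
      field
        cong     : ∀ P Q → P ∈ AllCrossings → P ≈ₚ Q → T P ≐ T Q
        size     : ∀ P → P ∈ AllCrossings → HasSize (T P) t
        disjoint : ∀ P Q → P ∈ AllCrossings → Q ∈ AllCrossings →
                   ¬ (P ≈ₚ Q) → T P ⊥ T Q

    module _ (T : Point → Pred X 0ℓ) where

      B : Fin p → Fin p → Pred X 0ℓ
      B i j x = ∃[ P ] P ∈ Crossings i j × x ∈ T P

      ℬ : Family X 0ℓ
      ℬ S = ∃[ i ] ∃[ j ] S ≐ B i j

{-# OPTIONS --safe #-}
-- Two lines meet exactly when their slopes differ, so |B i j ∩ B i′ j′| ≥ t unless the two sets
-- are distinct and lie in the same row (i = i′, j ≠ j′), in which case they are disjoint.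
-- Thus t-intersecting sub-families contain at most one set per row, and l(ℬ,t) = p.
--
-- Members of 𝒜^{t,+} are alone in their row, so p |𝒜^{t,+}| + |𝒜^{t,-}| ≤ p²; this is
-- β(ℬ,t,𝒜) ≥ 1/p, with equality for 𝒜 = ℬ.
--
-- For cross-t-intersecting 𝒜₁, …, 𝒜ₖ with k ≥ p, a row either meets only one 𝒜ₐ (in at most
-- p ≤ k sets), or contributes one and the same set to at most k of them.  Hence
-- Σ |𝒜ₐ| ≤ pk, and Π |𝒜ₐ| ≤ pᵏ by AM-GM.  For k < p, give two full rows to one 𝒜ₐ and
-- one full row to each of the others: the product is 2pᵏ.
module Submission where

open import Defs
open import Level using (0ℓ)
open import Algebra.Bundles using (CommutativeRing)
import Algebra.Properties.Group as GroupProperties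
open import Data.Fin.Base
  using (Fin; zero; suc; combine; remQuot; inject≤; fromℕ<; punchIn; splitAt; toℕ)
open import Data.Fin.Properties
  using (injective⇒≤; _≟_; any?; combine-injective; inject≤-injective; +↔⊎; *↔×; punchInᵢ≢i;
         toℕ-inject≤; toℕ-fromℕ<; toℕ<n)
open import Data.Integer.Base as ℤ using (+_)
import Data.Integer.Properties as ℤ
open import Data.List.Base using (List; []; _∷_; [_]; lookup; length; map; allFin; cartesianProduct)
open import Data.List.Membership.Propositional using (find; lose) renaming (_∈_ to _∈ₗ_)
open import Data.List.Membership.Propositional.Properties
  using (∈-lookup; ∈-cartesianProduct⁺; ∈-cartesianProduct⁻; ∈-allFin)
import Data.List.Membership.Setoid.Properties as MembershipS
open import Data.List.Properties using (length-map; length-++; length-tabulate)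
open import Data.List.Relation.Unary.All as All using ([]; _∷_)
import Data.List.Relation.Unary.All.Properties as All
open import Data.List.Relation.Unary.AllPairs using ([]; _∷_)
open import Data.List.Relation.Unary.Any as Any using (here; there)
import Data.List.Relation.Unary.Any.Properties as Any
open import Data.List.Relation.Unary.Unique.Propositional using (Unique)
import Data.List.Relation.Unary.Unique.Propositional.Properties as Unique
import Data.List.Relation.Unary.Unique.Setoid as Uniqueness
import Data.List.Relation.Unary.Unique.Setoid.Properties as UniqueS
open import Data.Nat.Base using (ℕ; zero; suc; _+_; _*_; _∸_; _^_; _≤_; _<_; NonZero; s≤s)
open import Data.Nat.Coprimality using (1-coprimeTo) renaming (sym to coprime-sym)
import Data.Nat.Properties as ℕ
open import Data.Nat.Tactic.RingSolver using (solve-∀)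
open import Data.Product.Base using (Σ; ∃-syntax; _×_; _,_; proj₁; proj₂; uncurry)
open import Data.Product.Properties using (≡-dec)
open import Data.Rational.Base as ℚ using (ℚ; mkℚ)
import Data.Rational.Properties as ℚ
open import Data.Rational.Unnormalised.Base as ℚᵘ using (mkℚᵘ)
import Data.Rational.Unnormalised.Properties as ℚᵘ
open import Data.Sum.Base using (_⊎_; inj₁; inj₂)
open import Data.Vec.Functional using (foldr)
open import Function.Base using (_∘_)
open import Function.Bundles using (_⇔_; mk⇔; Equivalence; Injection)
open import Function.Definitions using (Injective)
open import Function.Properties.Inverse using (↔⇒↣)
open import Relation.Binary.Bundles using (Setoid)
open import Relation.Binary.PropositionalEquality
  using (_≡_; _≢_; refl; sym; trans; cong; cong₂; subst; subst₂; setoid; module ≡-Reasoning)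
open import Relation.Nullary.Decidable using (Dec; yes; no; _×-dec_; ¬?)
open import Relation.Nullary.Negation using (¬_; contradiction)
open import Relation.Unary using (Pred; _∈_; _∩_; _⊆_; _≐_)

open Equivalence using (to; from)

-- Counting by injections between finite index types.

module _ {c e} (S : Setoid c e) where
  open Setoid S using (_≈_) renaming (sym to ≈-sym)
  open Uniqueness S using () renaming (Unique to UniqueIn)

  lookup-injective : ∀ {xs} → UniqueIn xs → Injective _≡_ _≈_ (lookup xs)
  lookup-injective (x∉ ∷ _) {zero}  {zero}  _  = refl
  lookup-injective (x∉ ∷ _) {zero}  {suc j} eq = contradiction eq (All.lookup x∉ (∈-lookup j))
  lookup-injective (x∉ ∷ _) {suc i} {zero}  eq = contradiction (≈-sym eq) (All.lookup x∉ (∈-lookup i))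
  lookup-injective (_ ∷ u)  {suc i} {suc j} eq = cong suc (lookup-injective u eq)

sum product : ∀ {k} → (Fin k → ℕ) → ℕ
sum     = foldr _+_ 0
product = foldr _*_ 1

splitAt-injective : ∀ a {b} → Injective _≡_ _≡_ (splitAt a {b})
splitAt-injective a = Injection.injective (↔⇒↣ (+↔⊎ {a}))

⊎-injective⇒≤ : ∀ {a b n} {f : Fin a ⊎ Fin b → Fin n} → Injective _≡_ _≡_ f → a + b ≤ n
⊎-injective⇒≤ {a} f-inj = injective⇒≤ (splitAt-injective a ∘ f-inj)

unsum : ∀ {k} (n : Fin k → ℕ) → Fin (sum n) → Σ (Fin k) (Fin ∘ n)
unsum {suc k} n x with splitAt (n zero) x
... | inj₁ y = zero , y
... | inj₂ y with unsum (n ∘ suc) y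
...   | i , z = suc i , z

unsum-injective : ∀ {k} (n : Fin k → ℕ) → Injective _≡_ _≡_ (unsum n)
unsum-injective {suc k} n {x} {x′} eq
  with splitAt (n zero) x in s | splitAt (n zero) x′ in s′
... | inj₁ y | inj₁ y′ with refl ← eq = splitAt-injective (n zero) (trans s (sym s′))
... | inj₂ y | inj₂ y′
  with unsum (n ∘ suc) y in u | unsum (n ∘ suc) y′ in u′ | eq
...   | _ | _ | refl with refl ← unsum-injective (n ∘ suc) (trans u (sym u′)) =
  splitAt-injective (n zero) (trans s (sym s′))

Σ-injective⇒sum≤ : ∀ {k m} (n : Fin k → ℕ) {f : Σ (Fin k) (Fin ∘ n) → Fin m} →
                   Injective _≡_ _≡_ f → sum n ≤ m
Σ-injective⇒sum≤ n f-inj = injective⇒≤ (unsum-injective n ∘ f-inj)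

product-const : ∀ {k} (a : Fin k → ℕ) {b} → (∀ i → a i ≡ b) → product a ≡ b ^ k
product-const {zero}  a eq = refl
product-const {suc k} a eq = cong₂ _*_ (eq zero) (product-const (a ∘ suc) (eq ∘ suc))

-- AM-GM over the natural numbers.

-- Raising `a` to `p` one unit at a time costs a factor `suc p` against a factor `p` at each step,
-- and a(p+1) ≤ p(a+1) because a ≤ p.
tangent-below : ∀ {p} a d → a + d ≡ p → a * suc p ^ d ≤ p * p ^ d
tangent-below {p} a zero    eq rewrite sym eq | ℕ.+-identityʳ a = ℕ.≤-refl
tangent-below {p} a (suc d) eq = begin
  a * (suc p * suc p ^ d)    ≡⟨ ℕ.*-assoc a (suc p) _ ⟨
  a * suc p * suc p ^ d      ≤⟨ ℕ.*-monoˡ-≤ (suc p ^ d) a[1+p]≤p[1+a] ⟩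
  p * suc a * suc p ^ d      ≡⟨ ℕ.*-assoc p (suc a) _ ⟩
  p * (suc a * suc p ^ d)    ≤⟨ ℕ.*-monoʳ-≤ p (tangent-below (suc a) d (trans (sym (ℕ.+-suc a d)) eq)) ⟩
  p * (p * p ^ d)            ∎
  where
  open ℕ.≤-Reasoning
  a[1+p]≤p[1+a] : a * suc p ≤ p * suc a
  a[1+p]≤p[1+a] = begin
    a * suc p  ≡⟨ ℕ.*-suc a p ⟩
    a + a * p  ≤⟨ ℕ.+-monoˡ-≤ (a * p) (ℕ.m+n≤o⇒m≤o a (ℕ.≤-reflexive eq)) ⟩
    p + a * p  ≡⟨ cong (λ x → p + x) (ℕ.*-comm a p) ⟩
    p + p * a  ≡⟨ ℕ.*-suc p a ⟨
    p * suc a  ∎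

-- Bernoulli's inequality 1 + d/p ≤ (1 + 1/p)^d with denominators cleared.
tangent-above : ∀ p d → (p + d) * p ^ d ≤ p * suc p ^ d
tangent-above p zero    rewrite ℕ.+-identityʳ p = ℕ.≤-refl
tangent-above p (suc d) = begin
  -- The added term is the surplus in (p+1)(p+d) = p(p+d+1) + d.
  (p + suc d) * (p * p ^ d)             ≤⟨ ℕ.m≤m+n _ (d * p ^ d) ⟩
  (p + suc d) * (p * p ^ d) + d * p ^ d ≡⟨ expand p d (p ^ d) ⟩
  suc p * ((p + d) * p ^ d)             ≤⟨ ℕ.*-monoʳ-≤ (suc p) (tangent-above p d) ⟩
  suc p * (p * suc p ^ d)               ≡⟨ swap (suc p) p _ ⟩
  p * (suc p * suc p ^ d)               ∎
  where
  open ℕ.≤-Reasoning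
  expand : ∀ p d x → (p + suc d) * (p * x) + d * x ≡ suc p * ((p + d) * x)
  expand = solve-∀
  swap : ∀ x y z → x * (y * z) ≡ y * (x * z)
  swap = solve-∀

-- Instead of the exponential tangent bound a / p ≤ exp (a / p - 1), AM-GM is derived from
-- its base-(p+1)/p analogue a / p ≤ ((p + 1) / p) ^ (a - p), with denominators cleared.
tangent : ∀ p a → a * p ^ a * suc p ^ p ≤ p * p ^ p * suc p ^ a
tangent p a with ℕ.≤-total a p
... | inj₁ a≤p with d , refl ← ℕ.m≤n⇒∃[o]m+o≡n a≤p = begin
  a * p ^ a * suc p ^ (a + d)            ≡⟨ cong (a * p ^ a *_) (ℕ.^-distribˡ-+-* (suc p) a d) ⟩
  a * p ^ a * (suc p ^ a * suc p ^ d)    ≡⟨ gather a (p ^ a) (suc p ^ a) (suc p ^ d) ⟩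
  a * suc p ^ d * (p ^ a * suc p ^ a)    ≤⟨ ℕ.*-monoˡ-≤ (p ^ a * suc p ^ a) (tangent-below a d refl) ⟩
  p * p ^ d * (p ^ a * suc p ^ a)        ≡⟨ spread p (p ^ d) (p ^ a) (suc p ^ a) ⟩
  p * (p ^ a * p ^ d) * suc p ^ a        ≡⟨ cong (λ x → p * x * suc p ^ a) (ℕ.^-distribˡ-+-* p a d) ⟨
  p * p ^ p * suc p ^ a                  ∎
  where
  open ℕ.≤-Reasoning
  gather : ∀ w x y z → w * x * (y * z) ≡ w * z * (x * y)
  gather = solve-∀
  spread : ∀ w x y z → w * x * (y * z) ≡ w * (y * x) * z
  spread = solve-∀
... | inj₂ p≤a with d , refl ← ℕ.m≤n⇒∃[o]m+o≡n p≤a = begin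
  a * p ^ (p + d) * suc p ^ p            ≡⟨ cong (λ x → a * x * suc p ^ p) (ℕ.^-distribˡ-+-* p p d) ⟩
  a * (p ^ p * p ^ d) * suc p ^ p        ≡⟨ gather a (p ^ p) (p ^ d) (suc p ^ p) ⟩
  a * p ^ d * (p ^ p * suc p ^ p)        ≤⟨ ℕ.*-monoˡ-≤ (p ^ p * suc p ^ p) (tangent-above p d) ⟩
  p * suc p ^ d * (p ^ p * suc p ^ p)    ≡⟨ spread p (suc p ^ d) (p ^ p) (suc p ^ p) ⟩
  p * p ^ p * (suc p ^ p * suc p ^ d)    ≡⟨ cong (p * p ^ p *_) (ℕ.^-distribˡ-+-* (suc p) p d) ⟨
  p * p ^ p * suc p ^ (p + d)            ∎
  where
  open ℕ.≤-Reasoning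
  gather : ∀ w x y z → w * (x * y) * z ≡ w * y * (x * z)
  gather = solve-∀
  spread : ∀ w x y z → w * x * (y * z) ≡ w * y * (z * x)
  spread = solve-∀

-- When the bounds `tangent` are multiplied together, the powers of (p+1)/p collect into one whose
-- exponent depends on the factors only through their sum.
product-tangent : ∀ p {k} (a : Fin k → ℕ) →
  product a * p ^ sum a * suc p ^ (p * k) ≤ p ^ k * p ^ (p * k) * suc p ^ sum a
product-tangent p {zero}  a rewrite ℕ.*-zeroʳ p = ℕ.≤-refl
product-tangent p {suc k} a = begin
  a₀ * Π * p ^ (a₀ + s) * suc p ^ (p * suc k)
    ≡⟨ cong₂ (λ x y → a₀ * Π * x * y) (ℕ.^-distribˡ-+-* p a₀ s) (^-*-suc (suc p)) ⟩
  a₀ * Π * (p ^ a₀ * p ^ s) * (suc p ^ p * suc p ^ (p * k))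
    ≡⟨ interchange a₀ Π (p ^ a₀) (p ^ s) (suc p ^ p) (suc p ^ (p * k)) ⟩
  (a₀ * p ^ a₀ * suc p ^ p) * (Π * p ^ s * suc p ^ (p * k))
    ≤⟨ ℕ.*-mono-≤ (tangent p a₀) (product-tangent p (a ∘ suc)) ⟩
  (p * p ^ p * suc p ^ a₀) * (p ^ k * p ^ (p * k) * suc p ^ s)
    ≡⟨ interchange p (p ^ k) (p ^ p) (p ^ (p * k)) (suc p ^ a₀) (suc p ^ s) ⟨
  p * p ^ k * (p ^ p * p ^ (p * k)) * (suc p ^ a₀ * suc p ^ s)
    ≡⟨ cong₂ (λ x y → p * p ^ k * x * y) (^-*-suc p) (ℕ.^-distribˡ-+-* (suc p) a₀ s) ⟨
  p * p ^ k * p ^ (p * suc k) * suc p ^ (a₀ + s) ∎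
  where
  open ℕ.≤-Reasoning
  a₀ = a zero
  Π  = product (a ∘ suc)
  s  = sum (a ∘ suc)
  ^-*-suc : ∀ x → x ^ (p * suc k) ≡ x ^ p * x ^ (p * k)
  ^-*-suc x = trans (cong (x ^_) (ℕ.*-suc p k)) (ℕ.^-distribˡ-+-* x p (p * k))
  interchange : ∀ u v w x y z → u * v * (w * x) * (y * z) ≡ (u * w * y) * (v * x * z)
  interchange = solve-∀

sum≤⇒product≤ : ∀ p .{{_ : NonZero p}} {k} (a : Fin k → ℕ) → sum a ≤ p * k → product a ≤ p ^ k
sum≤⇒product≤ p {k} a sum≤ with e , s+e≡pk ← ℕ.m≤n⇒∃[o]m+o≡n sum≤ =
  ℕ.*-cancelʳ-≤ (product a) (p ^ k) (p ^ s * suc p ^ (p * k)) (begin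
    product a * (p ^ s * suc p ^ (p * k))   ≡⟨ ℕ.*-assoc (product a) _ _ ⟨
    product a * p ^ s * suc p ^ (p * k)     ≤⟨ product-tangent p a ⟩
    p ^ k * p ^ (p * k) * suc p ^ s         ≡⟨ ℕ.*-assoc (p ^ k) _ _ ⟩
    p ^ k * (p ^ (p * k) * suc p ^ s)       ≤⟨ ℕ.*-monoʳ-≤ (p ^ k) shift ⟩
    p ^ k * (p ^ s * suc p ^ (p * k))       ∎)
  where
  open ℕ.≤-Reasoning
  s = sum a
  instance
    nonZero : NonZero (p ^ s * suc p ^ (p * k))
    nonZero = ℕ.m*n≢0 _ _ {{ℕ.m^n≢0 p s}} {{ℕ.m^n≢0 (suc p) (p * k)}}
  -- With the slack `e` of the sum below p k, this exchanges `e` factors `p` for factors `suc p`.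
  shift : p ^ (p * k) * suc p ^ s ≤ p ^ s * suc p ^ (p * k)
  shift = begin
    p ^ (p * k) * suc p ^ s        ≡⟨ cong (λ x → p ^ x * suc p ^ s) s+e≡pk ⟨
    p ^ (s + e) * suc p ^ s        ≡⟨ cong (_* suc p ^ s) (ℕ.^-distribˡ-+-* p s e) ⟩
    p ^ s * p ^ e * suc p ^ s      ≤⟨ ℕ.*-monoˡ-≤ (suc p ^ s) (ℕ.*-monoʳ-≤ (p ^ s) (ℕ.^-monoˡ-≤ e (ℕ.n≤1+n p))) ⟩
    p ^ s * suc p ^ e * suc p ^ s  ≡⟨ rotate (p ^ s) (suc p ^ e) (suc p ^ s) ⟩
    p ^ s * (suc p ^ s * suc p ^ e) ≡⟨ cong (p ^ s *_) (ℕ.^-distribˡ-+-* (suc p) s e) ⟨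
    p ^ s * suc p ^ (s + e)        ≡⟨ cong (λ x → p ^ s * suc p ^ x) s+e≡pk ⟩
    p ^ s * suc p ^ (p * k)        ∎
    where
    rotate : ∀ x y z → x * y * z ≡ x * (z * y)
    rotate = solve-∀

-- Auxiliary facts on lists, integral rationals and sizes of sets.

length-cartesianProduct : ∀ {a b} {A : Set a} {B : Set b} (xs : List A) (ys : List B) →
                          length (cartesianProduct xs ys) ≡ length xs * length ys
length-cartesianProduct []       ys = refl
length-cartesianProduct (x ∷ xs) ys = trans (length-++ (map (x ,_) ys))
  (cong₂ _+_ (length-map (x ,_) ys) (length-cartesianProduct xs ys))

-- The gcd that normalises `+ k / 1` does not reduce for a variable `k`; the explicit fraction
-- exposes numerator and denominator to the order and to reciprocals.
fromℕ≡ : ∀ k → fromℕ k ≡ mkℚ (+ k) 0 (coprime-sym (1-coprimeTo k))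
fromℕ≡ k = ℚ.normalize-coprime (coprime-sym (1-coprimeTo k))

fromℕ-cancel-≤ : ∀ {m n} → fromℕ m ℚ.≤ fromℕ n → m ≤ n
fromℕ-cancel-≤ {m} {n} le with ℚ.*≤* le′ ← subst₂ ℚ._≤_ (fromℕ≡ m) (fromℕ≡ n) le =
  ℤ.drop‿+≤+ (subst₂ ℤ._≤_ (ℤ.*-identityʳ _) (ℤ.*-identityʳ _) le′)

fromℕ-cancel-< : ∀ {m n} → fromℕ m ℚ.< fromℕ n → m < n
fromℕ-cancel-< {m} {n} lt with ℚ.*<* lt′ ← subst₂ ℚ._<_ (fromℕ≡ m) (fromℕ≡ n) lt =
  ℤ.drop‿+<+ (subst₂ ℤ._<_ (ℤ.*-identityʳ _) (ℤ.*-identityʳ _) lt′)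

module _ {X : Set} where
  open Cardinality (setoid X) public using () renaming (HasSizeAtLeast to HasAtLeast)
  open Setoid (Sets X) public using () renaming (refl to ≐-refl; sym to ≐-sym; trans to ≐-trans)

  HasAtLeast-mono : ∀ {P Q : Pred X 0ℓ} {n} → P ⊆ Q → HasAtLeast P n → HasAtLeast Q n
  HasAtLeast-mono P⊆Q (xs , u , eq , all) = xs , u , eq , All.map P⊆Q all

-- Sub-families of a square grid of sets, known only through which pairs meet.

module Multipartite {X : Set} {n t : ℕ} (B : Fin (2 + n) → Fin (2 + n) → Pred X 0ℓ)
  (meet⇔ : ∀ {i j i′ j′} → (i ≡ i′ → j ≡ j′) ⇔ HasAtLeast (B i j ∩ B i′ j′) t) where

  p : ℕ
  p = 2 + n

  Code : Set
  Code = Fin p × Fin p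

  _≟ᶜ_ : (u v : Code) → Dec (u ≡ v)
  _≟ᶜ_ = ≡-dec _≟_ _≟_

  𝐁 : Code → Pred X 0ℓ
  𝐁 = uncurry B

  𝔅 : Family X 0ℓ
  𝔅 S = ∃[ i ] ∃[ j ] S ≐ B i j

  -- Adjacency, loops included, in the complete multipartite graph whose parts are the rows.
  Compatible : Code → Code → Set
  Compatible (i , j) (i′ , j′) = i ≡ i′ → j ≡ j′

  compatible⇔ : ∀ {A A′ u v} → A ≐ 𝐁 u → A′ ≐ 𝐁 v → Compatible u v ⇔ HasAtLeast (A ∩ A′) t
  compatible⇔ (A⊆ , ⊆A) (A′⊆ , ⊆A′) = mk⇔
    (HasAtLeast-mono (λ (x∈ , x∈′) → ⊆A x∈ , ⊆A′ x∈′) ∘ to meet⇔)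
    (from meet⇔ ∘ HasAtLeast-mono (λ (x∈ , x∈′) → A⊆ x∈ , A′⊆ x∈′))

  -- If i ≢ i′, then B i′ j″ with j″ ≢ j′ meets B i j but not B i′ j′.
  𝐁-injective : ∀ {u v} → 𝐁 u ≐ 𝐁 v → u ≡ v
  𝐁-injective {i , j} {i′ , j′} eq with i ≟ i′
  ... | yes refl = cong (i ,_)
    (from (compatible⇔ {u = i , j} {v = i , j′} ≐-refl eq) (to meet⇔ (λ _ → refl)) refl)
  ... | no i≢i′ = contradiction
    (from (compatible⇔ {u = i′ , j′} {v = i′ , punchIn j′ zero} eq ≐-refl)
          (to (compatible⇔ {u = i , j} {v = i′ , punchIn j′ zero} ≐-refl ≐-refl)
            (λ i≡i′ → contradiction i≡i′ i≢i′))
          refl)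
    (punchInᵢ≢i j′ zero ∘ sym)

  ∈ᶠ⇒code : ∀ {A} (𝒜 : SubFamily 𝔅) → A ∈ᶠ 𝒜 → ∃[ u ] A ≐ 𝐁 u
  ∈ᶠ⇒code 𝒜 A∈ with i , j , eq ← All.lookup (SubFamily.sub 𝒜) (∈-lookup (Any.index A∈)) =
    (i , j) , ≐-trans (Any.lookup-index A∈) eq

  lookup-∈ᶠ : ∀ (𝒜 : SubFamily 𝔅) x → lookup (members 𝒜) x ∈ᶠ 𝒜
  lookup-∈ᶠ 𝒜 = MembershipS.∈-lookup (Sets X) (members 𝒜)

  -- Passing from list positions to grid codes lets members be counted by injections, and makes
  -- questions about rows decidable.
  code : (𝒜 : SubFamily 𝔅) → Fin ∣ 𝒜 ∣ → Code
  code 𝒜 x = proj₁ (∈ᶠ⇒code 𝒜 (lookup-∈ᶠ 𝒜 x))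

  code-≐ : ∀ 𝒜 x → lookup (members 𝒜) x ≐ 𝐁 (code 𝒜 x)
  code-≐ 𝒜 x = proj₂ (∈ᶠ⇒code 𝒜 (lookup-∈ᶠ 𝒜 x))

  ≡⇒≐ : ∀ {A A′ u v} → A ≐ 𝐁 u → A′ ≐ 𝐁 v → u ≡ v → A ≐ A′
  ≡⇒≐ A≐ A′≐ refl = ≐-trans A≐ (≐-sym A′≐)

  code-injective : ∀ 𝒜 → Injective _≡_ _≡_ (code 𝒜)
  code-injective 𝒜 {x} {y} eq =
    lookup-injective (Sets X) (SubFamily.unique 𝒜) (≡⇒≐ (code-≐ 𝒜 x) (code-≐ 𝒜 y) eq)

  ⊆⇒∣∣≤ : ∀ {𝒜 𝒜′ : SubFamily 𝔅} → (∀ {A} → A ∈ᶠ 𝒜 → A ∈ᶠ 𝒜′) → ∣ 𝒜 ∣ ≤ ∣ 𝒜′ ∣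
  ⊆⇒∣∣≤ {𝒜} 𝒜⊆𝒜′ = injective⇒≤ λ {x} {y} eq →
    lookup-injective (Sets X) (SubFamily.unique 𝒜)
      (MembershipS.index-injective (Sets X) (𝒜⊆𝒜′ (lookup-∈ᶠ 𝒜 x)) (𝒜⊆𝒜′ (lookup-∈ᶠ 𝒜 y)) eq)

  ≋⇒∣∣≡ : ∀ {𝒜 𝒜′ : SubFamily 𝔅} → 𝒜 ≋ 𝒜′ → ∣ 𝒜 ∣ ≡ ∣ 𝒜′ ∣
  ≋⇒∣∣≡ {𝒜} {𝒜′} 𝒜≋𝒜′ = ℕ.≤-antisym
    (⊆⇒∣∣≤ {𝒜} {𝒜′} (to (𝒜≋𝒜′ _))) (⊆⇒∣∣≤ {𝒜′} {𝒜} (from (𝒜≋𝒜′ _)))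

  grid : ∀ {is js} → Unique is → Unique js → SubFamily 𝔅
  grid {is} {js} is! js! = record
    { members = map 𝐁 (cartesianProduct is js)
    ; unique  = UniqueS.map⁺ (setoid Code) (Sets X) 𝐁-injective (Unique.cartesianProduct⁺ is! js!)
    ; sub     = All.map⁺ (All.universal (λ (i , j) → i , j , ≐-refl) _)
    }

  ∣grid∣ : ∀ {is js} (is! : Unique is) (js! : Unique js) → ∣ grid is! js! ∣ ≡ length is * length js
  ∣grid∣ {is} {js} _ _ = trans (length-map 𝐁 (cartesianProduct is js)) (length-cartesianProduct is js)

  ∈-grid⁺ : ∀ {A i j is js} {is! : Unique is} {js! : Unique js} →
            i ∈ₗ is → j ∈ₗ js → A ≐ B i j → A ∈ᶠ grid is! js!
  ∈-grid⁺ i∈ j∈ A≐ = Any.map⁺ (lose (∈-cartesianProduct⁺ i∈ j∈) A≐)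

  ∈-grid⁻ : ∀ {A is js} (is! : Unique is) (js! : Unique js) → A ∈ᶠ grid is! js! →
            ∃[ i ] ∃[ j ] i ∈ₗ is × j ∈ₗ js × A ≐ B i j
  ∈-grid⁻ {is = is} {js} _ _ A∈ with (i , j) , ij∈ , A≐ ← find (Any.map⁻ A∈) =
    let i∈ , j∈ = ∈-cartesianProduct⁻ is js ij∈ in i , j , i∈ , j∈ , A≐

  all! : Unique (allFin p)
  all! = Unique.allFin⁺ p

  ∣allFin∣ : length (allFin p) ≡ p
  ∣allFin∣ = length-tabulate {n = p} (λ i → i)

  -- Largest intersecting sub-families.

  -- The row map is injective on members, since different sets in one row do not meet.
  intersecting⇒≤p : ∀ 𝒜 → IsIntersecting t 𝒜 → ∣ 𝒜 ∣ ≤ p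
  intersecting⇒≤p 𝒜 int = injective⇒≤ {f = proj₁ ∘ code 𝒜} λ {x} {y} → same-row x y
    where
    same-row : ∀ x y → proj₁ (code 𝒜 x) ≡ proj₁ (code 𝒜 y) → x ≡ y
    same-row x y i≡ with x ≟ y
    ... | yes x≡y = x≡y
    ... | no x≢y  = code-injective 𝒜 (cong₂ _,_ i≡
      (from (compatible⇔ (code-≐ 𝒜 x) (code-≐ 𝒜 y))
        (int _ _ (lookup-∈ᶠ 𝒜 x) (lookup-∈ᶠ 𝒜 y)
          (x≢y ∘ lookup-injective (Sets X) (SubFamily.unique 𝒜))) i≡))

  -- A transversal of the rows, showing that the bound `p` is attained.
  column : SubFamily 𝔅
  column = grid {js = [ zero ]} all! ([] ∷ [])

  column-intersecting : IsIntersecting t column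
  column-intersecting A A′ A∈ A′∈ _
    with i  , .zero , _ , here refl , A≐  ← ∈-grid⁻ {js = [ zero ]} all! ([] ∷ []) A∈
    with i′ , .zero , _ , here refl , A′≐ ← ∈-grid⁻ {js = [ zero ]} all! ([] ∷ []) A′∈ =
    to (compatible⇔ A≐ A′≐) (λ _ → refl)

  largest⇒≡p : ∀ {ℒ : SubFamily 𝔅} → IsLargestIntersecting t ℒ → ∣ ℒ ∣ ≡ p
  largest⇒≡p {ℒ} (int , largest) = ℕ.≤-antisym (intersecting⇒≤p ℒ int) (begin
    p                      ≡⟨ ∣allFin∣ ⟨
    length (allFin p)      ≡⟨ ℕ.*-identityʳ _ ⟨
    length (allFin p) * 1  ≡⟨ ∣grid∣ {js = [ zero ]} all! ([] ∷ []) ⟨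
    ∣ column ∣             ≤⟨ largest column column-intersecting ⟩
    ∣ ℒ ∣                  ∎)
    where open ℕ.≤-Reasoning

  -- The product bound for at least p cross-intersecting sub-families.

  module _ {k} (𝒜 : Fin k → SubFamily 𝔅) (cross : AreCrossIntersecting t 𝒜) (p≤k : p ≤ k) where

    -- Phrased with codes instead of sets, so that a search over finite index types decides it.
    HitElsewhere : Fin k → Fin p → Set
    HitElsewhere a i = ∃[ a′ ] a ≢ a′ × ∃[ x ] proj₁ (code (𝒜 a′) x) ≡ i

    hitElsewhere? : ∀ a i → Dec (HitElsewhere a i)
    hitElsewhere? a i = any? λ a′ → ¬? (a ≟ a′) ×-dec any? λ x → proj₁ (code (𝒜 a′) x) ≟ i

    -- If only 𝒜 a has members in row i, they are kept apart by their columns, of which there are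
    -- p ≤ k; otherwise all the members in row i are equal, and a itself is used in place of a column.
    place : Fin k → Code → Fin k
    place a (i , j) with hitElsewhere? a i
    ... | yes _ = a
    ... | no  _ = inject≤ j p≤k

    place-hit : ∀ {a} u → HitElsewhere a (proj₁ u) → place a u ≡ a
    place-hit {a} (i , j) hit with hitElsewhere? a i
    ... | yes _   = refl
    ... | no ¬hit = contradiction hit ¬hit

    place-cancel : ∀ {a i j j′} → (HitElsewhere a i → j ≡ j′) →
                   place a (i , j) ≡ place a (i , j′) → j ≡ j′
    place-cancel {a} {i} {j} {j′} hit⇒≡ eq with hitElsewhere? a i
    ... | yes hit = hit⇒≡ hit
    ... | no  _   = inject≤-injective p≤k p≤k j j′ eq

    cross-compatible : ∀ {a a′} → a ≢ a′ → ∀ x x′ → Compatible (code (𝒜 a) x) (code (𝒜 a′) x′)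
    cross-compatible {a} {a′} a≢a′ x x′ = from (compatible⇔ (code-≐ (𝒜 a) x) (code-≐ (𝒜 a′) x′))
      (cross a a′ a≢a′ _ _ (lookup-∈ᶠ (𝒜 a) x) (lookup-∈ᶠ (𝒜 a′) x′))

    -- Each of the `p` rows offers `k` cells, so injectivity bounds the sum of the sizes by p k.
    cell : Σ (Fin k) (Fin ∘ ∣_∣ ∘ 𝒜) → Fin (p * k)
    cell (a , x) = combine (proj₁ (code (𝒜 a) x)) (place a (code (𝒜 a) x))

    cell-injective : Injective _≡_ _≡_ cell
    cell-injective {a , x} {a′ , x′} eq
      with i≡i′ , place≡ ← combine-injective (proj₁ (code (𝒜 a) x)) _ (proj₁ (code (𝒜 a′) x′)) _ eq
      with a ≟ a′
    -- If another sub-family has a member `y` in this row, compatibility with `y` forces both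
    -- columns to be that of `y`; otherwise `place` records the column.
    ... | yes refl = cong (a ,_) (code-injective (𝒜 a) (cong₂ _,_ i≡i′ (place-cancel
      (λ (b , a≢b , y , hit) → trans (cross-compatible a≢b x y (trans i≡i′ (sym hit)))
                                     (sym (cross-compatible a≢b x′ y (sym hit))))
      (trans (cong (λ i → place a (i , _)) (sym i≡i′)) place≡))))
    -- Each of the two members witnesses that the row of the other is hit elsewhere, so the places
    -- are `a` and `a′` themselves.
    ... | no a≢a′ = contradiction
      (begin
        a                         ≡⟨ place-hit (code (𝒜 a) x) (a′ , a≢a′ , x′ , sym i≡i′) ⟨
        place a (code (𝒜 a) x)    ≡⟨ place≡ ⟩
        place a′ (code (𝒜 a′) x′) ≡⟨ place-hit (code (𝒜 a′) x′) (a , a≢a′ ∘ sym , x , i≡i′) ⟩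
        a′                        ∎)
      a≢a′
      where open ≡-Reasoning

    cross⇒productOfSizes≤ : productOfSizes 𝒜 ≤ p ^ k
    cross⇒productOfSizes≤ =
      sum≤⇒product≤ p (∣_∣ ∘ 𝒜) (Σ-injective⇒sum≤ (∣_∣ ∘ 𝒜) cell-injective)

  -- `IsIntersecting` is silent about equal members, which may now come from two different indices;
  -- for them `compatible⇔` applies, as every code is compatible with itself.
  largest⇒cross : ∀ {k} {ℒ : SubFamily 𝔅} → IsLargestIntersecting t ℒ →
                  (𝒜 : Fin k → SubFamily 𝔅) → (∀ a → 𝒜 a ≋ ℒ) → AreCrossIntersecting t 𝒜
  largest⇒cross {ℒ = ℒ} (int , _) 𝒜 𝒜≋ℒ a a′ _ A A′ A∈ A′∈
    with u , A≐ ← ∈ᶠ⇒code (𝒜 a) A∈ | v , A′≐ ← ∈ᶠ⇒code (𝒜 a′) A′∈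
    with u ≟ᶜ v
  ... | yes refl = to (compatible⇔ A≐ A′≐) (λ _ → refl)
  ... | no u≢v   = int A A′ (to (𝒜≋ℒ a A) A∈) (to (𝒜≋ℒ a′ A′) A′∈)
    λ A≐A′ → u≢v (𝐁-injective (≐-trans (≐-sym A≐) (≐-trans A≐A′ A′≐)))

  -- A larger product for fewer than p sub-families.

  module _ {k} (k<p : suc k < p) where

    -- There are `suc k` sub-families, owning rows 0 to `k`; the row numbered `suc k` is the first
    -- spare one.
    newRow : Fin p
    newRow = fromℕ< k<p

    oldRow : Fin (suc k) → Fin p
    oldRow a = inject≤ a (ℕ.<⇒≤ k<p)

    oldRow≢newRow : ∀ a → oldRow a ≢ newRow
    oldRow≢newRow a eq = ℕ.<⇒≢ (toℕ<n a) (begin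
      toℕ a           ≡⟨ toℕ-inject≤ a _ ⟨
      toℕ (oldRow a)  ≡⟨ cong toℕ eq ⟩
      toℕ newRow      ≡⟨ toℕ-fromℕ< k<p ⟩
      suc k           ∎)
      where open ≡-Reasoning

    rows : Fin (suc k) → List (Fin p)
    rows zero      = oldRow zero ∷ newRow ∷ []
    rows a@(suc _) = oldRow a ∷ []

    rows! : ∀ a → Unique (rows a)
    rows! zero    = (oldRow≢newRow zero ∷ []) ∷ [] ∷ []
    rows! (suc _) = [] ∷ []

    rows-disjoint : ∀ {a a′ i} → i ∈ₗ rows a → i ∈ₗ rows a′ → a ≡ a′
    rows-disjoint {zero} {zero} _ _ = refl
    rows-disjoint {suc a} {suc a′} (here refl) (here eq) =
      inject≤-injective (ℕ.<⇒≤ k<p) (ℕ.<⇒≤ k<p) (suc a) (suc a′) eq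
    rows-disjoint {zero} {suc a′} (here refl) (here ())
    rows-disjoint {zero} {suc a′} (there (here refl)) (here eq) =
      contradiction (sym eq) (oldRow≢newRow (suc a′))
    rows-disjoint {suc a} {zero} (here refl) (here ())
    rows-disjoint {suc a} {zero} (here refl) (there (here eq)) =
      contradiction eq (oldRow≢newRow (suc a))

    rowFamilies : Fin (suc k) → SubFamily 𝔅
    rowFamilies a = grid (rows! a) all!

    -- Different sub-families own disjoint sets of rows, so compatibility is vacuous.
    rowFamilies-cross : AreCrossIntersecting t rowFamilies
    rowFamilies-cross a a′ a≢a′ A A′ A∈ A′∈
      with i  , j  , i∈  , _ , A≐  ← ∈-grid⁻ (rows! a) all! A∈
      with i′ , j′ , i′∈ , _ , A′≐ ← ∈-grid⁻ (rows! a′) all! A′∈ =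
      to (compatible⇔ A≐ A′≐) λ { refl → contradiction (rows-disjoint i∈ i′∈) a≢a′ }

    rowFamilies-product : productOfSizes rowFamilies ≡ 2 * p ^ suc k
    rowFamilies-product = begin
      ∣ rowFamilies zero ∣ * product (∣_∣ ∘ rowFamilies ∘ suc)
        ≡⟨ cong₂ _*_ (trans (∣grid∣ (rows! zero) all!) (cong (2 *_) ∣allFin∣))
                     (product-const (∣_∣ ∘ rowFamilies ∘ suc) λ a →
                       trans (∣grid∣ (rows! (suc a)) all!) (trans (ℕ.*-identityˡ _) ∣allFin∣)) ⟩
      2 * p * p ^ k
        ≡⟨ ℕ.*-assoc 2 p (p ^ k) ⟩
      2 * (p * p ^ k) ∎
      where open ≡-Reasoning

  -- The values of β and κ.

  open Cardinality (Sets X) using (HasSize)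

  Plus-resp-≐ : ∀ {A A′} (𝒜 : SubFamily 𝔅) → A ≐ A′ → Plus t 𝒜 A → Plus t 𝒜 A′
  Plus-resp-≐ 𝒜 A≐A′ (A∈ , meets) =
    Any.map (≐-trans (≐-sym A≐A′)) A∈ ,
    λ C C∈ C≭A′ → HasAtLeast-mono (λ (x∈ , x∈′) → proj₁ A≐A′ x∈ , x∈′)
      (meets C C∈ λ C≐A → C≭A′ (≐-trans C≐A A≐A′))

  -- A member of `Plus` meets every other member, whereas different sets in one row do not meet.
  Plus-alone : ∀ {A A′ u v} (𝒜 : SubFamily 𝔅) → Plus t 𝒜 A → A′ ∈ᶠ 𝒜 → A ≐ 𝐁 u → A′ ≐ 𝐁 v →
               proj₁ u ≡ proj₁ v → A ≐ A′
  Plus-alone {u = u} {v} 𝒜 (_ , meets) A′∈ A≐ A′≐ i≡ with u ≟ᶜ v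
  ... | yes u≡v = ≡⇒≐ A≐ A′≐ u≡v
  ... | no u≢v  = contradiction
    (cong₂ _,_ i≡ (from (compatible⇔ A≐ A′≐)
      (meets _ A′∈ λ A′≐A → u≢v (𝐁-injective (≐-trans (≐-sym A≐) (≐-trans (≐-sym A′≐A) A′≐)))) i≡))
    u≢v

  module _ (𝒜 : SubFamily 𝔅) {a b}
    (size⁺ : HasSize (Plus t 𝒜) a) (size⁻ : HasSize (Minus t 𝒜) b) where

    private
      xs = proj₁ size⁺
      ys = proj₁ size⁻

      plus : ∀ x → Plus t 𝒜 (lookup xs x)
      plus x = from (proj₂ (proj₂ (proj₂ size⁺)) _) (MembershipS.∈-lookup (Sets X) xs x)

      minus : ∀ y → Minus t 𝒜 (lookup ys y)
      minus y = from (proj₂ (proj₂ (proj₂ size⁻)) _) (MembershipS.∈-lookup (Sets X) ys y)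

      code⁺ : ∀ x → ∃[ u ] lookup xs x ≐ 𝐁 u
      code⁺ x = ∈ᶠ⇒code 𝒜 (proj₁ (plus x))

      code⁻ : ∀ y → ∃[ u ] lookup ys y ≐ 𝐁 u
      code⁻ y = ∈ᶠ⇒code 𝒜 (proj₁ (minus y))

      row⁺ : Fin (length xs) → Fin p
      row⁺ = proj₁ ∘ proj₁ ∘ code⁺

      -- A member of Plus is alone in its row, so it may occupy all p cells of that row.
      occupy : Fin (length xs * p) ⊎ Fin (length ys) → Fin (p * p)
      occupy (inj₁ z) = combine (row⁺ (proj₁ (remQuot p z))) (proj₂ (remQuot {length xs} p z))
      occupy (inj₂ y) = uncurry combine (proj₁ (code⁻ y))

      plus-row-injective : ∀ x x′ → row⁺ x ≡ row⁺ x′ → x ≡ x′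
      plus-row-injective x x′ eq = lookup-injective (Sets X) (proj₁ (proj₂ size⁺))
        (Plus-alone 𝒜 (plus x) (proj₁ (plus x′)) (proj₂ (code⁺ x)) (proj₂ (code⁺ x′)) eq)

      plus-row≢minus-row : ∀ x y → row⁺ x ≢ proj₁ (proj₁ (code⁻ y))
      plus-row≢minus-row x y eq = proj₂ (minus y) (Plus-resp-≐ 𝒜
        (Plus-alone 𝒜 (plus x) (proj₁ (minus y)) (proj₂ (code⁺ x)) (proj₂ (code⁻ y)) eq) (plus x))

      occupy-injective : Injective _≡_ _≡_ occupy
      occupy-injective {inj₁ z} {inj₁ z′} eq
        with row≡ , col≡ ← combine-injective (row⁺ (proj₁ (remQuot p z))) _
                                             (row⁺ (proj₁ (remQuot p z′))) _ eq =
        cong inj₁ (Injection.injective (↔⇒↣ (*↔× {length xs} {p}))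
          (cong₂ _,_ (plus-row-injective (proj₁ (remQuot p z)) _ row≡) col≡))
      occupy-injective {inj₁ z} {inj₂ y} eq = contradiction
        (proj₁ (combine-injective _ _ (proj₁ (proj₁ (code⁻ y))) _ eq))
        (plus-row≢minus-row (proj₁ (remQuot p z)) y)
      occupy-injective {inj₂ y} {inj₁ z} eq = contradiction
        (sym (proj₁ (combine-injective (proj₁ (proj₁ (code⁻ y))) _ _ _ eq)))
        (plus-row≢minus-row (proj₁ (remQuot p z)) y)
      occupy-injective {inj₂ y} {inj₂ y′} eq
        with i≡ , j≡ ← combine-injective (proj₁ (proj₁ (code⁻ y))) _
                                         (proj₁ (proj₁ (code⁻ y′))) _ eq =
        cong inj₂ (lookup-injective (Sets X) (proj₁ (proj₂ size⁻))
          (≡⇒≐ (proj₂ (code⁻ y)) (proj₂ (code⁻ y′)) (cong₂ _,_ i≡ j≡)))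

    -- For positive `b` this is 1/p ≤ (p - a)/b with denominators cleared.
    size⁺*p+size⁻≤p*p : a * p + b ≤ p * p
    size⁺*p+size⁻≤p*p = subst₂ (λ a b → a * p + b ≤ p * p)
      (proj₁ (proj₂ (proj₂ size⁺))) (proj₁ (proj₂ (proj₂ size⁻))) (⊎-injective⇒≤ occupy-injective)

  -- Serves the case `minus-empty`, where the value is p/f and must be at least 1/p.
  HasSize-𝔅⇒≤ : ∀ {f} → HasSize 𝔅 f → f ≤ p * p
  HasSize-𝔅⇒≤ (xs , xs! , refl , ∈⇔) = injective⇒≤ {f = uncurry combine ∘ proj₁ ∘ decode}
    λ {x} {y} eq → lookup-injective (Sets X) xs! (≡⇒≐ (proj₂ (decode x)) (proj₂ (decode y))
      (let i≡ , j≡ = combine-injective (proj₁ (proj₁ (decode x))) _ (proj₁ (proj₁ (decode y))) _ eq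
       in cong₂ _,_ i≡ j≡))
    where
    decode : ∀ x → ∃[ u ] lookup xs x ≐ 𝐁 u
    decode x = let i , j , eq = from (∈⇔ _) (MembershipS.∈-lookup (Sets X) xs x) in (i , j) , eq

  -- The value 1/p: `mkℚ` stores the denominator less one, and `suc n` is p - 1.
  β : ℚ
  β = mkℚ (+ 1) (suc n) (1-coprimeTo p)

  -- The comparison is made among unnormalised rationals, where `z / suc d` keeps its numerator and
  -- denominator and cross-multiplication is direct.
  ≤⇒β≤ : ∀ z d → + suc d ℤ.≤ z ℤ.* + p → β ℚ.≤ z ℚ./ suc d
  ≤⇒β≤ z d d≤zp = ℚ.toℚᵘ-cancel-≤ (ℚᵘ.≤-respʳ-≃ (ℚᵘ.≃-sym (ℚ.toℚᵘ-fromℚᵘ (mkℚᵘ z d)))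
    (ℚᵘ.*≤* (subst (ℤ._≤ z ℤ.* + p) (sym (ℤ.*-identityˡ (+ suc d))) d≤zp)))

  β-minimal : ∀ 𝒜 q → Is-βAt 𝔅 t 𝒜 q → β ℚ.≤ q
  β-minimal 𝒜 _ (minus-nonempty {a = a} {b} (ℒ , largest , refl) size⁺ size⁻)
    rewrite largest⇒≡p {ℒ} largest = ≤⇒β≤ (+ p ℤ.- + a) b (begin
      + suc b                    ≤⟨ ℤ.+≤+ (ℕ.m+n≤o⇒m≤o∸n (suc b) bound) ⟩
      + (p * p ∸ a * p)          ≡⟨ cong +_ (ℕ.*-distribʳ-∸ p p a) ⟨
      + ((p ∸ a) * p)            ≡⟨ ℤ.pos-* (p ∸ a) p ⟩
      + (p ∸ a) ℤ.* + p          ≡⟨ cong (ℤ._* + p) (ℤ.⊖-≥ a≤p) ⟨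
      (p ℤ.⊖ a) ℤ.* + p          ≡⟨ cong (ℤ._* + p) (ℤ.[+m]-[+n]≡m⊖n p a) ⟨
      (+ p ℤ.- + a) ℤ.* + p      ∎)
    where
    open ℤ.≤-Reasoning
    bound : suc b + a * p ≤ p * p
    bound = subst (_≤ p * p) (ℕ.+-comm (a * p) (suc b)) (size⁺*p+size⁻≤p*p 𝒜 size⁺ size⁻)
    -- Makes the truncated `p ∸ a` agree with the integer difference.
    a≤p : a ≤ p
    a≤p = ℕ.*-cancelʳ-≤ a p p (ℕ.m+n≤o⇒n≤o (suc b) bound)
  β-minimal 𝒜 _ (minus-empty {f = f} (ℒ , largest , refl) _ size)
    rewrite largest⇒≡p {ℒ} largest =
    ≤⇒β≤ (+ p) f (subst (+ suc f ℤ.≤_) (ℤ.pos-* p p) (ℤ.+≤+ (HasSize-𝔅⇒≤ size)))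

  whole : SubFamily 𝔅
  whole = grid all! all!

  ∈-whole : ∀ {A} u → A ≐ 𝐁 u → A ∈ᶠ whole
  ∈-whole (i , j) = ∈-grid⁺ {is! = all!} {js! = all!} (∈-allFin i) (∈-allFin j)

  -- Every set has another one in its own row, in the column `punchIn j zero`.
  Plus-whole-empty : ∀ {A} → ¬ Plus t whole A
  Plus-whole-empty {A} plus with (i , j) , A≐ ← ∈ᶠ⇒code whole (proj₁ plus) = contradiction
    (cong proj₂ (𝐁-injective {i , punchIn j zero} {i , j} (≐-sym (≐-trans (≐-sym A≐)
      (Plus-alone whole plus (∈-whole (i , punchIn j zero) ≐-refl) A≐
        (≐-refl {x = B i (punchIn j zero)}) refl)))))
    (punchInᵢ≢i j zero)

  β-attained : ∀ {ℒ : SubFamily 𝔅} → IsLargestIntersecting t ℒ → Is-βAt 𝔅 t whole β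
  β-attained {ℒ} largest = subst (Is-βAt 𝔅 t whole)
    -- The value at `whole` is (p - 0)/(p p); equivalent unnormalised fractions have the same normal
    -- form.
    (trans (ℚ.fromℚᵘ-cong {mkℚᵘ (+ p ℤ.- + 0) _} {mkℚᵘ (+ 1) (suc n)} (ℚᵘ.*≡* p*p≡)) (ℚ.fromℚᵘ-toℚᵘ β))
    (minus-nonempty (ℒ , largest , largest⇒≡p {ℒ} largest)
      ([] , [] , refl , λ A → mk⇔ (λ plus → contradiction plus Plus-whole-empty) λ ())
      (members whole , SubFamily.unique whole
        , trans (∣grid∣ all! all!) (cong₂ _*_ ∣allFin∣ ∣allFin∣)
        , λ A → mk⇔ proj₁ (_, Plus-whole-empty)))
    where
    p*p≡ : (+ p ℤ.- + 0) ℤ.* + p ≡ + 1 ℤ.* + (p * p)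
    p*p≡ = trans (cong (ℤ._* + p) (ℤ.+-identityʳ (+ p)))
      (trans (sym (ℤ.pos-* p p)) (sym (ℤ.*-identityˡ _)))

  Is-κ-p : ∀ {ℒ : SubFamily 𝔅} → IsLargestIntersecting t ℒ → Is-κ 𝔅 t (fromℕ p)
  -- The reciprocal of `β` computes to the explicit fraction in `fromℕ≡ p`.
  Is-κ-p {ℒ} largest = β , ((whole , β-attained {ℒ} largest) , β-minimal) , _ , fromℕ≡ p

-- Intersections of the lines and of the sets assigned to them.

module Geometry (ℝ : RealNumbers) where
  open RealNumbers ℝ using (Carrier; _#_; #⇒invertible; #-irrefl; commutativeRing)
  open CommutativeRing commutativeRing
    using (_≈_; _-_; 1#; +-congʳ; +-congˡ; *-congʳ; *-congˡ; +-assoc; +-comm;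
      *-assoc; *-identityˡ; distribʳ; +-group)
    renaming (_+_ to _+ᴿ_; _*_ to _*ᴿ_; refl to ≈-refl; sym to ≈-sym; trans to ≈-trans;
      setoid to ≈-setoid)
  open GroupProperties +-group using (//-rightDividesˡ; ∙-cancelˡ)
  open Lines ℝ

  -- The solution is (b′ - b)/(a - a′); apartness supplies the inverse `e` of a - a′.
  solve-linear : ∀ {a a′} b b′ → a # a′ → ∃[ x ] a *ᴿ x +ᴿ b ≈ a′ *ᴿ x +ᴿ b′
  solve-linear {a} {a′} b b′ a#a′ with e , _ , inverse ← #⇒invertible a#a′ = x , (begin
    a *ᴿ x +ᴿ b                      ≈⟨ +-congʳ (*-congʳ (//-rightDividesˡ a′ a)) ⟨
    ((a - a′) +ᴿ a′) *ᴿ x +ᴿ b       ≈⟨ +-congʳ (distribʳ x (a - a′) a′) ⟩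
    ((a - a′) *ᴿ x +ᴿ a′ *ᴿ x) +ᴿ b  ≈⟨ +-congʳ (+-comm _ _) ⟩
    (a′ *ᴿ x +ᴿ (a - a′) *ᴿ x) +ᴿ b  ≈⟨ +-assoc _ _ _ ⟩
    a′ *ᴿ x +ᴿ ((a - a′) *ᴿ x +ᴿ b)  ≈⟨ +-congˡ (+-congʳ cancel) ⟩
    a′ *ᴿ x +ᴿ ((b′ - b) +ᴿ b)       ≈⟨ +-congˡ (//-rightDividesˡ b b′) ⟩
    a′ *ᴿ x +ᴿ b′                    ∎)
    where
    open import Relation.Binary.Reasoning.Setoid ≈-setoid
    x = e *ᴿ (b′ - b)
    cancel : (a - a′) *ᴿ x ≈ b′ - b
    cancel = begin
      (a - a′) *ᴿ (e *ᴿ (b′ - b))  ≈⟨ *-assoc _ _ _ ⟨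
      (a - a′) *ᴿ e *ᴿ (b′ - b)    ≈⟨ *-congʳ inverse ⟩
      1# *ᴿ (b′ - b)               ≈⟨ *-identityˡ _ ⟩
      b′ - b                       ∎

  module _ {p} (m c : Fin p → Carrier) (m# : Distinct m) (c# : Distinct c) where

    nonparallel-meet : ∀ {i i′} → i ≢ i′ → ∀ j j′ → ∃[ P ] P ∈ Line m c i j ∩ Line m c i′ j′
    nonparallel-meet {i} {i′} i≢i′ j j′ with x , eq ← solve-linear (c j) (c j′) (m# i i′ i≢i′) =
      (x , m i *ᴿ x +ᴿ c j) , (x , ≈-refl , ≈-refl) , (x , ≈-refl , eq)

    -- At a common abscissa the terms with slope `m i` cancel, leaving equal intercepts.
    parallel-disjoint : ∀ {i j j′ P Q} → j ≢ j′ → P ∈ Line m c i j → Q ∈ Line m c i j′ → ¬ (P ≈ₚ Q)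
    parallel-disjoint {i} {j} {j′} j≢j′ (x , P₁ , P₂) (x′ , Q₁ , Q₂) (PQ₁ , PQ₂) =
      #-irrefl (∙-cancelˡ (m i *ᴿ x) _ _ (begin
        m i *ᴿ x +ᴿ c j    ≈⟨ P₂ ⟨
        _                  ≈⟨ PQ₂ ⟩
        _                  ≈⟨ Q₂ ⟩
        m i *ᴿ x′ +ᴿ c j′  ≈⟨ +-congʳ (*-congˡ (≈-trans (≈-sym Q₁) (≈-trans (≈-sym PQ₁) P₁))) ⟩
        m i *ᴿ x +ᴿ c j′   ∎)) (c# j j′ j≢j′)
      where open import Relation.Binary.Reasoning.Setoid ≈-setoid

  module _ {X : Set} {n t} (1≤t : 1 ≤ t) (m c : Fin (2 + n) → Carrier)
    (m# : Distinct m) (c# : Distinct c) (T : Point → Pred X 0ℓ)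
    (assignment : IsDisjointAssignment m c t T) where

    open IsDisjointAssignment assignment using (size; disjoint)

    -- The common point `P` is a crossing on both lines, so all `t` elements of `T P` lie in both
    -- sets.
    nonparallel-HasAtLeast : ∀ {i i′} → i ≢ i′ → ∀ j j′ → HasAtLeast (B m c T i j ∩ B m c T i′ j′) t
    nonparallel-HasAtLeast {i} {i′} i≢i′ j j′
      with P , P∈ , P∈′ ← nonparallel-meet m c m# c# i≢i′ j j′
      with xs , xs! , eq , ∈⇔ ← size P (i , j , i′ , j′ , i≢i′ ∘ sym ∘ cong proj₁ , P∈ , P∈′) =
      xs , xs! , eq , All.tabulate λ {x} x∈ →
        (P , (i′ , j′ , i≢i′ ∘ sym ∘ cong proj₁ , P∈ , P∈′) , from (∈⇔ x) x∈) ,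
        (P , (i , j , i≢i′ ∘ cong proj₁ , P∈′ , P∈) , from (∈⇔ x) x∈)

    meet⇔ : ∀ {i j i′ j′} → (i ≡ i′ → j ≡ j′) ⇔ HasAtLeast (B m c T i j ∩ B m c T i′ j′) t
    meet⇔ {i} {j} {i′} {j′} = mk⇔ meets compatible
      where
      meets : (i ≡ i′ → j ≡ j′) → HasAtLeast (B m c T i j ∩ B m c T i′ j′) t
      meets i≡⇒j≡ with i ≟ i′
      ... | no i≢i′ = nonparallel-HasAtLeast i≢i′ j j′
      -- A set has at least `t` elements because its line crosses one of another slope.
      ... | yes refl with refl ← i≡⇒j≡ refl = HasAtLeast-mono (λ (x∈ , _) → x∈ , x∈)
        (nonparallel-HasAtLeast (punchInᵢ≢i i zero ∘ sym) j j)

      compatible : HasAtLeast (B m c T i j ∩ B m c T i′ j′) t → i ≡ i′ → j ≡ j′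
      -- The hypothesis `1 ≤ t` guarantees an actual common element.
      compatible ([] , _ , refl , _) _ = contradiction 1≤t λ ()
      compatible (x ∷ _ , _ , _ , ((P , P∈ , x∈) , (Q , Q∈ , x∈′)) ∷ _) refl with j ≟ j′
      ... | yes j≡j′ = j≡j′
      -- The element `x` lies in both `T P` and `T Q`, but `P` and `Q` are on distinct parallel
      -- lines and so differ.
      ... | no j≢j′  = contradiction (x∈ , x∈′) (disjoint P Q (i , j , P∈) (i , j′ , Q∈)
        (parallel-disjoint m c m# c# j≢j′ (on-line P∈) (on-line Q∈)))
        where
        on-line : ∀ {i j P} → P ∈ Crossings m c i j → P ∈ Line m c i j
        on-line (_ , _ , _ , P∈ , _) = P∈

theorem5p4 :
    ∀ (ℝ : RealNumbers) (X : Set) (t p : ℕ) → 1 ≤ t → 3 ≤ p →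
    let open RealNumbers ℝ using (Carrier)
        open Lines ℝ
    in
    ∀ (m c : Fin p → Carrier) → Distinct m → Distinct c →
    ∀ (T : Point → Pred X 0ℓ) → IsDisjointAssignment m c t T →
    ∀ (ℒ : SubFamily (ℬ m c T)) → IsLargestIntersecting t ℒ →
    ∃[ κ ] Is-κ (ℬ m c T) t κ
      × (κ ≡ fromℕ ∣ ℒ ∣ × ∣ ℒ ∣ ≡ p)
      × (∀ (k : ℕ) → 1 ≤ k →
         ∀ (𝒜 : Fin k → SubFamily (ℬ m c T)) → (∀ i → 𝒜 i ≋ ℒ) →
           AreCrossIntersecting t 𝒜
           × (κ ℚ.≤ fromℕ k → HasMaximumProduct t 𝒜)
           × (fromℕ k ℚ.< κ → ¬ HasMaximumProduct t 𝒜))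
theorem5p4 ℝ X t (suc (suc n)) 1≤t (s≤s (s≤s _)) m c m# c# T assignment ℒ largest =
  fromℕ p , Is-κ-p {ℒ} largest , (cong fromℕ (sym ∣ℒ∣≡p) , ∣ℒ∣≡p) , powers
  where
  open Geometry ℝ
  open Lines ℝ using (B)
  open Multipartite (B m c T) (meet⇔ 1≤t m c m# c# T assignment)

  ∣ℒ∣≡p : ∣ ℒ ∣ ≡ p
  ∣ℒ∣≡p = largest⇒≡p {ℒ} largest

  powers : ∀ (k : ℕ) → 1 ≤ k → (𝒜 : Fin k → SubFamily 𝔅) → (∀ i → 𝒜 i ≋ ℒ) →
           AreCrossIntersecting t 𝒜
           × (fromℕ p ℚ.≤ fromℕ k → HasMaximumProduct t 𝒜)
           × (fromℕ k ℚ.< fromℕ p → ¬ HasMaximumProduct t 𝒜)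
  powers (suc k) _ 𝒜 𝒜≋ℒ = largest⇒cross {ℒ = ℒ} largest 𝒜 𝒜≋ℒ , maximum , not-maximum
    where
    𝒜-product : productOfSizes 𝒜 ≡ p ^ suc k
    𝒜-product = product-const (∣_∣ ∘ 𝒜) λ i → trans (≋⇒∣∣≡ {𝒜 i} {ℒ} (𝒜≋ℒ i)) ∣ℒ∣≡p

    maximum : fromℕ p ℚ.≤ fromℕ (suc k) → HasMaximumProduct t 𝒜
    maximum p≤k 𝒜′ cross = ℕ.≤-trans (cross⇒productOfSizes≤ 𝒜′ cross (fromℕ-cancel-≤ {p} {suc k} p≤k))
      (ℕ.≤-reflexive (sym 𝒜-product))

    not-maximum : fromℕ (suc k) ℚ.< fromℕ p → ¬ HasMaximumProduct t 𝒜
    -- With q = `p ^ suc k` positive, `2 * q` unfolds to `q + (q + 0)`, which exceeds q.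
    not-maximum lt max = ℕ.<⇒≱ (ℕ.m<m+n (p ^ suc k) (ℕ.<-≤-trans (ℕ.m^n>0 p (suc k)) (ℕ.m≤m+n _ 0)))
      (subst₂ _≤_ (rowFamilies-product k<p) 𝒜-product (max (rowFamilies k<p) (rowFamilies-cross k<p)))
      where
      k<p : suc k < p
      k<p = fromℕ-cancel-< {suc k} lt
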